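{- Let $n,m,k \geq 0$, $w \in P(n,m)$ and $u \in P(m,k)$. Then $\mathbf{blno}^{w \otimes u, x} = \mathbf{blno}^{u,x} \circ \mathbf{blno}^{w,x}$ as maps from $\{0,1,\ldots,n\}$ to $\{0,1,\ldots,k\}$.
   Context: $P(n,m)$ denotes the set of words $w \in \{x,y\}^{*}$ with exactly $n$ occurrences of $x$ and $m$ occurrences of $y$. Blocks: the $m$ occurrences of $y$ split $w\in P(n,m)$ into $m+1$ (possibly empty) words $\mathbf{bl}^{w,x}_0,\ldots,\mathbf{bl}^{w,x}_m \in \{x\}^{*}$ with $w = \mathbf{bl}^{w,x}_0 \, y\, \mathbf{bl}^{w,x}_1\, y \cdots y\, \mathbf{bl}^{w,x}_m$; similarly the $n$ occurrences of $x$ split $w$ into words $\mathbf{bl}^{w,y}_0,\ldots,\mathbf{bl}^{w,y}_n \in \{y\}^{*}$ with $w = \mathbf{bl}^{w,y}_0\, x\, \mathbf{bl}^{w,y}_1\, x\cdots x\, \mathbf{bl}^{w,y}_n$. For $i \in \{1,\ldots,n\}$, $\mathbf{blno}^{w,x}_i \in \{0,\ldots,m\}$ is the index of the $x$-block containing the $i$-th occurrence of $x$ in $w$, i.e. the number of $y$'s preceding the $i$-th occurrence of $x$; by convention $\mathbf{blno}^{w,x}_0 = 0$. The map $\mathbf{blno}^{w,x} : \{0,\ldots,n\} \to \{0,\ldots,m\}$ sends $i$ to $\mathbf{blno}^{w,x}_i$. (The assignment $w \mapsto \mathbf{blno}^{w,x}$ is a bijection from $P(n,m)$ to the set of monotone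 maps $\{0,\ldots,n\} \to \{0,\ldots,m\}$ sending $0$ to $0$.) Product: for $w \in P(n,m)$ and $u \in P(m,k)$, $w \otimes u := \mathbf{bl}^{w,x}_0\, \mathbf{bl}^{u,y}_0\, \mathbf{bl}^{w,x}_1\, \mathbf{bl}^{u,y}_1 \cdots \mathbf{bl}^{w,x}_m\, \mathbf{bl}^{u,y}_m \in P(n,k)$. -}

module Defs where

open import Data.Fin.Base using (Fin; zero; suc; toℕ; fromℕ<)
open import Data.List.Base as List using (List; []; _∷_; _++_; length; filter)
open import Data.List.Properties using (length-++; filter-++)
open import Data.Nat.Base using (ℕ; zero; suc; _+_; _≤_; s≤s; z≤n)
open import Data.Nat.Properties using (+-identityʳ; +-commutativeSemigroup; ≤-reflexive; ≤-trans)
open import Data.Vec.Base using (Vec; []; _∷_; toList; zipWith)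
open import Data.Vec.Relation.Unary.All using (All; []; _∷_)
open import Algebra.Properties.CommutativeSemigroup +-commutativeSemigroup using (interchange)
open import Relation.Binary.Definitions using (DecidableEquality)
open import Relation.Binary.PropositionalEquality
  using (_≡_; refl; trans; cong; cong₂; subst; module ≡-Reasoning)
open import Relation.Nullary.Decidable.Core using (yes; no)

data Letter : Set where
  x y : Letter

_≟_ : DecidableEquality Letter
x ≟ x = yes refl
x ≟ y = no λ ()
y ≟ x = no λ ()
y ≟ y = yes refl

Word : Set
Word = List Letter

# : Letter → Word → ℕ
# c w = length (filter (_≟ c) w)

record P (n m : ℕ) : Set where
  constructor mkP
  field
    word : Word
    #x   : # x word ≡ n
    #y   : # y word ≡ m

open P public

consHead : ∀ {l} → Letter → Vec Word (suc l) → Vec Word (suc l)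
consHead a (b ∷ bs) = (a ∷ b) ∷ bs

-- The words between consecutive occurrences of the separating letter.
split : (c : Letter) (w : Word) → Vec Word (suc (# c w))
split c []      = [] ∷ []
split x (x ∷ w) = [] ∷ split x w
split x (y ∷ w) = consHead y (split x w)
split y (x ∷ w) = consHead x (split y w)
split y (y ∷ w) = [] ∷ split y w

-- The blocks bl^{w,x}_0, …, bl^{w,x}_m; the x-blocks are separated by the y's.
blˣ : ∀ {n m} → P n m → Vec Word (suc m)
blˣ w = subst (λ l → Vec Word (suc l)) (#y w) (split y (word w))

blʸ : ∀ {n m} → P n m → Vec Word (suc n)
blʸ w = subst (λ l → Vec Word (suc l)) (#x w) (split x (word w))

-- b₀ c b₁ c ⋯ c bₗ
join : ∀ {l} → Letter → Vec Word (suc l) → Word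
join c (b ∷ [])      = b
join c (b ∷ b′ ∷ bs) = b ++ c ∷ join c (b′ ∷ bs)

join-[]∷ : ∀ {l} c (bs : Vec Word (suc l)) → join c ([] ∷ bs) ≡ c ∷ join c bs
join-[]∷ c (b ∷ bs) = refl

join-consHead : ∀ {l} c a (bs : Vec Word (suc l)) → join c (consHead a bs) ≡ a ∷ join c bs
join-consHead c a (b ∷ [])      = refl
join-consHead c a (b ∷ b′ ∷ bs) = refl

join-split : ∀ c w → join c (split c w) ≡ w
join-split c []      = refl
join-split x (x ∷ w) = trans (join-[]∷ x (split x w)) (cong (x ∷_) (join-split x w))
join-split x (y ∷ w) = trans (join-consHead x y (split x w)) (cong (y ∷_) (join-split x w))
join-split y (x ∷ w) = trans (join-consHead y x (split y w)) (cong (x ∷_) (join-split y w))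
join-split y (y ∷ w) = trans (join-[]∷ y (split y w)) (cong (y ∷_) (join-split y w))

join-blˣ : ∀ {n m} (w : P n m) → join y (blˣ w) ≡ word w
join-blˣ (mkP w refl refl) = join-split y w

join-blʸ : ∀ {n m} (w : P n m) → join x (blʸ w) ≡ word w
join-blʸ (mkP w refl refl) = join-split x w

#-consHead : ∀ {l} {c a} {bs : Vec Word (suc l)} → # c (a ∷ []) ≡ 0 →
             All (λ b → # c b ≡ 0) bs → All (λ b → # c b ≡ 0) (consHead a bs)
#-consHead {c = x} {y} _ (p ∷ ps) = p ∷ ps
#-consHead {c = y} {x} _ (p ∷ ps) = p ∷ ps

#-split≡0 : ∀ c w → All (λ b → # c b ≡ 0) (split c w)
#-split≡0 x []      = refl ∷ []
#-split≡0 y []      = refl ∷ []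
#-split≡0 x (x ∷ w) = refl ∷ #-split≡0 x w
#-split≡0 x (y ∷ w) = #-consHead refl (#-split≡0 x w)
#-split≡0 y (x ∷ w) = #-consHead refl (#-split≡0 y w)
#-split≡0 y (y ∷ w) = refl ∷ #-split≡0 y w

#-blˣ : ∀ {n m} (w : P n m) → All (λ b → # y b ≡ 0) (blˣ w)
#-blˣ (mkP w refl refl) = #-split≡0 y w

#-blʸ : ∀ {n m} (w : P n m) → All (λ b → # x b ≡ 0) (blʸ w)
#-blʸ (mkP w refl refl) = #-split≡0 x w

-- b₀ c₀ b₁ c₁ ⋯ bₗ cₗ
interleave : ∀ {l} → Vec Word l → Vec Word l → Word
interleave bs cs = List.concat (toList (zipWith _++_ bs cs))

#-++ : ∀ c v w → # c (v ++ w) ≡ # c v + # c w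
#-++ c v w = trans (cong length (filter-++ (_≟ c) v w)) (length-++ (filter (_≟ c) v))

#-concat : ∀ {l} → Letter → Vec Word l → ℕ
#-concat c bs = # c (List.concat (toList bs))

#-interleave : ∀ {l} c (bs cs : Vec Word l) →
               # c (interleave bs cs) ≡ #-concat c bs + #-concat c cs
#-interleave x [] [] = refl
#-interleave y [] [] = refl
#-interleave c (b ∷ bs) (d ∷ ds) = begin
  # c ((b ++ d) ++ interleave bs ds)
    ≡⟨ #-++ c (b ++ d) (interleave bs ds) ⟩
  # c (b ++ d) + # c (interleave bs ds)
    ≡⟨ cong₂ _+_ (#-++ c b d) (#-interleave c bs ds) ⟩
  (# c b + # c d) + (#-concat c bs + #-concat c ds)
    ≡⟨ interchange (# c b) (# c d) (#-concat c bs) (#-concat c ds) ⟩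
  (# c b + #-concat c bs) + (# c d + #-concat c ds)
    ≡⟨ cong₂ _+_ (#-++ c b _) (#-++ c d _) ⟨
  #-concat c (b ∷ bs) + #-concat c (d ∷ ds) ∎
  where open ≡-Reasoning

#-concat≡0 : ∀ {l} c {bs : Vec Word l} → All (λ b → # c b ≡ 0) bs → #-concat c bs ≡ 0
#-concat≡0 x [] = refl
#-concat≡0 y [] = refl
#-concat≡0 c {b ∷ bs} (p ∷ ps) = trans (#-++ c b _) (cong₂ _+_ p (#-concat≡0 c ps))

#-concat-join : ∀ {l} c d → # c (d ∷ []) ≡ 0 → (bs : Vec Word (suc l)) →
                #-concat c bs ≡ # c (join d bs)
#-concat-join c d q (b ∷ []) =
  trans (#-++ c b []) (trans (cong (# c b +_) (#-[] c)) (+-identityʳ _))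
  where
  #-[] : ∀ c → # c [] ≡ 0
  #-[] x = refl
  #-[] y = refl
#-concat-join c d q (b ∷ b′ ∷ bs) = begin
  #-concat c (b ∷ b′ ∷ bs)                  ≡⟨ #-++ c b _ ⟩
  # c b + #-concat c (b′ ∷ bs)              ≡⟨ cong (# c b +_) (#-concat-join c d q (b′ ∷ bs)) ⟩
  # c b + # c (join d (b′ ∷ bs))            ≡⟨ cong (λ z → # c b + (z + # c (join d (b′ ∷ bs)))) q ⟨
  # c b + (# c (d ∷ []) + # c (join d (b′ ∷ bs)))
                                            ≡⟨ cong (# c b +_) (#-++ c (d ∷ []) (join d (b′ ∷ bs))) ⟨
  # c b + # c (d ∷ join d (b′ ∷ bs))        ≡⟨ #-++ c b _ ⟨
  # c (b ++ d ∷ join d (b′ ∷ bs))           ∎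
  where open ≡-Reasoning

infixr 7 _⊗_

_⊗_ : ∀ {n m k} → P n m → P m k → P n k
word (w ⊗ u) = interleave (blˣ w) (blʸ u)
#x (_⊗_ {n} w u) = begin
  # x (interleave (blˣ w) (blʸ u))          ≡⟨ #-interleave x (blˣ w) (blʸ u) ⟩
  #-concat x (blˣ w) + #-concat x (blʸ u)   ≡⟨ cong₂ _+_ (#-concat-join x y refl (blˣ w))
                                                         (#-concat≡0 x (#-blʸ u)) ⟩
  # x (join y (blˣ w)) + 0                  ≡⟨ +-identityʳ _ ⟩
  # x (join y (blˣ w))                      ≡⟨ cong (# x) (join-blˣ w) ⟩
  # x (word w)                              ≡⟨ #x w ⟩
  n                                         ∎
  where open ≡-Reasoning
#y (_⊗_ {k = k} w u) = begin
  # y (interleave (blˣ w) (blʸ u))          ≡⟨ #-interleave y (blˣ w) (blʸ u) ⟩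
  #-concat y (blˣ w) + #-concat y (blʸ u)   ≡⟨ cong₂ _+_ (#-concat≡0 y (#-blˣ w))
                                                         (#-concat-join y x refl (blʸ u)) ⟩
  # y (join x (blʸ u))                      ≡⟨ cong (# y) (join-blʸ u) ⟩
  # y (word u)                              ≡⟨ #y u ⟩
  k                                         ∎
  where open ≡-Reasoning

-- The prefix of a word preceding the occurrence of x with 0-based number i
-- (the whole word if there is no such occurrence).
beforeX : ℕ → Word → Word
beforeX i       []      = []
beforeX i       (y ∷ w) = y ∷ beforeX i w
beforeX zero    (x ∷ w) = []
beforeX (suc i) (x ∷ w) = x ∷ beforeX i w

#y-beforeX≤ : ∀ i w → # y (beforeX i w) ≤ # y w
#y-beforeX≤ i       []      = z≤n
#y-beforeX≤ i       (y ∷ w) = s≤s (#y-beforeX≤ i w)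
#y-beforeX≤ zero    (x ∷ w) = z≤n
#y-beforeX≤ (suc i) (x ∷ w) = #y-beforeX≤ i w

-- blno^{w,x}; the argument suc i stands for the occurrence of x with
-- 1-based number suc (toℕ i), hence 0-based number toℕ i.
blnoˣ : ∀ {n m} → P n m → Fin (suc n) → Fin (suc m)
blnoˣ w zero    = zero
blnoˣ w (suc i) =
  fromℕ< (s≤s (≤-trans (#y-beforeX≤ (toℕ i) (word w)) (≤-reflexive (#y w))))

{-# OPTIONS --safe #-}
module Submission where

open import Defs
open import Data.Fin.Base using (zero; suc; toℕ)
open import Data.Fin.Properties using (toℕ-fromℕ<; toℕ-injective; toℕ<n)
open import Data.List.Base using ([]; _∷_)
open import Data.Nat.Base using (ℕ; zero; suc; _<_; s≤s)
open import Data.Vec.Base using (Vec; []; _∷_)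
open import Data.Vec.Relation.Unary.All using (All; []; _∷_)
open import Function.Base using (_∘_)
open import Relation.Binary.PropositionalEquality
  using (_≡_; _≗_; refl; sym; trans; cong; module ≡-Reasoning)

-- `blnoˣ` freed of its `Fin` bounds, so that an induction can shorten words without carrying proofs
-- of letter counts. Past the last x it counts every y.
ysBefore : ℕ → Word → ℕ
ysBefore zero    w = 0
ysBefore (suc i) w = # y (beforeX i w)

toℕ-blnoˣ : ∀ {n m} (w : P n m) i → toℕ (blnoˣ w i) ≡ ysBefore (toℕ i) (word w)
toℕ-blnoˣ w zero    = refl
toℕ-blnoˣ w (suc i) = toℕ-fromℕ< _

-- The head x shifts indices by one; for `zero` it is itself the x sought, with no y before it, in
-- agreement with the convention at index 0.
#-beforeX-x∷ : ∀ i w → # y (beforeX i (x ∷ w)) ≡ ysBefore i w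
#-beforeX-x∷ zero    w = refl
#-beforeX-x∷ (suc i) w = refl

-- Both sides change alike when a letter is removed from the first block b of bs or,
-- once b is empty, from the first block of cs. When both are empty, the separator y
-- after b matches the separator x in join x cs.
ysBefore-interleave : ∀ {l} (bs cs : Vec Word (suc l)) →
                      All (λ b → # y b ≡ 0) bs → All (λ c → # x c ≡ 0) cs →
                      ∀ i → i < # x (join y bs) →
                      ysBefore (suc i) (interleave bs cs) ≡
                      ysBefore (ysBefore (suc i) (join y bs)) (join x cs)
ysBefore-interleave ((y ∷ b) ∷ bs) cs (() ∷ ps) qs i i<
ysBefore-interleave ((x ∷ b) ∷ []) (c ∷ cs) ps qs zero i< = refl
ysBefore-interleave ((x ∷ b) ∷ []) (c ∷ cs) (p ∷ ps) qs (suc i) (s≤s i<) =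
  ysBefore-interleave (b ∷ []) (c ∷ cs) (p ∷ ps) qs i i<
ysBefore-interleave ((x ∷ b) ∷ b′ ∷ bs) (c ∷ cs) ps qs zero i< = refl
ysBefore-interleave ((x ∷ b) ∷ b′ ∷ bs) (c ∷ cs) (p ∷ ps) qs (suc i) (s≤s i<) =
  ysBefore-interleave (b ∷ b′ ∷ bs) (c ∷ cs) (p ∷ ps) qs i i<
-- No x is left. Without the bound the left side would count the ys in `cs`, while the right side
-- would be 0.
ysBefore-interleave ([] ∷ []) cs ps qs i ()
ysBefore-interleave ([] ∷ b ∷ bs) ((x ∷ c) ∷ cs) ps (() ∷ qs) i i<
-- The separator y ahead of the x sought makes the inner index a successor, so the outer count
-- passes this y of `cs` too.
ysBefore-interleave ([] ∷ b ∷ bs) ((y ∷ c) ∷ c′ ∷ cs) ps (q ∷ qs) i i< =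
  cong suc (ysBefore-interleave ([] ∷ b ∷ bs) (c ∷ c′ ∷ cs) ps (q ∷ qs) i i<)
ysBefore-interleave ([] ∷ b ∷ bs) ([] ∷ c ∷ cs) (_ ∷ ps) (_ ∷ qs) i i< =
  trans (ysBefore-interleave (b ∷ bs) (c ∷ cs) ps qs i i<)
        (sym (#-beforeX-x∷ (ysBefore (suc i) (join y (b ∷ bs))) (join x (c ∷ cs))))

ysBefore-⊗ : ∀ {n m k} (w : P n m) (u : P m k) i → i < n →
             ysBefore (suc i) (word (w ⊗ u)) ≡
             ysBefore (ysBefore (suc i) (word w)) (word u)
ysBefore-⊗ w u i i<n
  -- Bound before the `rewrite` so that its type is rewritten: the joins become the words and the
  -- bound becomes `i < n`.
  with eq ← ysBefore-interleave (blˣ w) (blʸ u) (#-blˣ w) (#-blʸ u) i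
  rewrite join-blˣ w | join-blʸ u | #x w = eq i<n

proposition1 : ∀ (n m k : ℕ) (w : P n m) (u : P m k) →
    blnoˣ (w ⊗ u) ≗ blnoˣ u ∘ blnoˣ w
proposition1 n m k w u zero    = refl
proposition1 n m k w u (suc i) = toℕ-injective (begin
  toℕ (blnoˣ (w ⊗ u) (suc i))
    ≡⟨ toℕ-blnoˣ (w ⊗ u) (suc i) ⟩
  ysBefore (suc (toℕ i)) (word (w ⊗ u))
    ≡⟨ ysBefore-⊗ w u (toℕ i) (toℕ<n i) ⟩
  ysBefore (ysBefore (suc (toℕ i)) (word w)) (word u)
    ≡⟨ cong (λ j → ysBefore j (word u)) (toℕ-blnoˣ w (suc i)) ⟨
  ysBefore (toℕ (blnoˣ w (suc i))) (word u)
    -- `blnoˣ w (suc i)` may be `zero`; then the convention at index 0 is used.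
    ≡⟨ toℕ-blnoˣ u (blnoˣ w (suc i)) ⟨
  toℕ (blnoˣ u (blnoˣ w (suc i))) ∎)
  where open ≡-Reasoning
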